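{- Let $t>s\ge 2$ and $n\ge 3t-3$ be integers. Then $$\mathrm{wsat}(K_n,K_{s,t})\ge (s-1)(n-t+1)+\binom{t}{2}.$$
   Context: All graphs are finite and simple; $K_n$ is the complete graph on $n$ vertices and $K_{a,b}$ is the complete bipartite graph with parts of sizes $a$ and $b$. A copy of a graph $H$ in a graph $G$ is a (not necessarily induced) subgraph of $G$ isomorphic to $H$. Let $F$ and $H$ be graphs. A spanning subgraph $G$ of $F$ is weakly $(F,H)$-saturated if $G$ contains no copy of $H$, but there is an ordering $e_1,\ldots,e_k$ of $E(F)\setminus E(G)$ such that for each $i\in\{1,\dots,k\}$ the graph $G\cup\{e_1,\ldots,e_i\}$ contains a copy $H'$ of $H$ with $e_i\in E(H')$. The weak saturation number $\mathrm{wsat}(F,H)$ is the minimum number of edges of a weakly $(F,H)$-saturated graph. -}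

module Defs where

open import Data.Empty using (⊥)
open import Data.Fin.Base using (Fin; toℕ; splitAt)
open import Data.Fin.Properties using (_≟_; _<?_)
open import Data.List.Base using (List; length; filter; take; lookup; allFin; cartesianProduct)
import Data.List.Membership.DecPropositional as DecMembership
open import Data.List.Relation.Unary.Unique.Propositional using (Unique)
open import Data.Nat.Base using (ℕ; suc; _+_; _≤_)
open import Data.Product.Base using (Σ-syntax; ∃-syntax; _×_; _,_)
open import Data.Product.Properties using (≡-dec)
open import Data.Sum.Base as Sum using (_⊎_; inj₁; inj₂)
open import Data.Unit.Base using (⊤; tt)
open import Function.Bundles using (_⇔_)
open import Function.Definitions using (Injective)
open import Level using (0ℓ)
open import Relation.Binary.Core using (Rel; _=[_]⇒_; _⇒_)
open import Relation.Binary.Definitions using (Decidable; Symmetric; Irreflexive)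
open import Relation.Binary.PropositionalEquality using (_≡_; _≢_; refl; ≢-sym)
open import Relation.Nullary.Decidable using (yes; no; ¬?; _×-dec_; _⊎-dec_)
open import Relation.Nullary.Negation using (¬_)

record Graph (n : ℕ) : Set₁ where
  field
    Adj        : Rel (Fin n) 0ℓ
    adj?       : Decidable Adj
    adj-sym    : Symmetric Adj
    adj-irrefl : Irreflexive _≡_ Adj

open Graph public

VertexPair : ℕ → Set
VertexPair n = Fin n × Fin n

module _ {n : ℕ} where
  open DecMembership (≡-dec (_≟_ {n}) (_≟_ {n})) public using (_∈_; _∉_; _∈?_)

-- The unordered edge {u , v} is listed once, as the pair (u , v) with u < v.
edges : ∀ {n} → Graph n → List (VertexPair n)
edges {n} G =
  filter (λ (u , v) → (u <? v) ×-dec adj? G u v) (cartesianProduct (allFin n) (allFin n))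

edgeCount : ∀ {n} → Graph n → ℕ
edgeCount G = length (edges G)

K : ∀ n → Graph n
K n = record
  { Adj        = _≢_
  ; adj?       = λ u v → ¬? (u ≟ v)
  ; adj-sym    = ≢-sym
  ; adj-irrefl = λ u≡v u≢v → u≢v u≡v
  }

OppositeParts : ∀ {A B : Set} → Rel (A ⊎ B) 0ℓ
OppositeParts (inj₁ _) (inj₁ _) = ⊥
OppositeParts (inj₁ _) (inj₂ _) = ⊤
OppositeParts (inj₂ _) (inj₁ _) = ⊤
OppositeParts (inj₂ _) (inj₂ _) = ⊥

oppositeParts? : ∀ {A B : Set} → Decidable (OppositeParts {A} {B})
oppositeParts? (inj₁ _) (inj₁ _) = no λ ()
oppositeParts? (inj₁ _) (inj₂ _) = yes tt
oppositeParts? (inj₂ _) (inj₁ _) = yes tt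
oppositeParts? (inj₂ _) (inj₂ _) = no λ ()

oppositeParts-sym : ∀ {A B : Set} → Symmetric (OppositeParts {A} {B})
oppositeParts-sym {x = inj₁ _} {inj₂ _} _ = tt
oppositeParts-sym {x = inj₂ _} {inj₁ _} _ = tt

oppositeParts-irrefl : ∀ {A B : Set} → Irreflexive _≡_ (OppositeParts {A} {B})
oppositeParts-irrefl {x = inj₁ _} refl ()
oppositeParts-irrefl {x = inj₂ _} refl ()

-- The parts are the first a and the last b of the a + b vertices.
Kbip : ∀ a b → Graph (a + b)
Kbip a b = record
  { Adj        = λ u v → OppositeParts (splitAt a u) (splitAt a v)
  ; adj?       = λ u v → oppositeParts? (splitAt a u) (splitAt a v)
  ; adj-sym    = λ {u} {v} → oppositeParts-sym {x = splitAt a u} {splitAt a v}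
  ; adj-irrefl = λ { {u} refl → oppositeParts-irrefl {x = splitAt a u} refl }
  }

SpanningSubgraph : ∀ {n} → Graph n → Graph n → Set
SpanningSubgraph G F = Adj G ⇒ Adj F

-- The copy itself is the image of H under the embedding; its edges are the
-- images of the edges of H, so non-edges of H may map to edges of G.
record Copy {k n} (H : Graph k) (G : Graph n) : Set where
  field
    embed     : Fin k → Fin n
    injective : Injective _≡_ _≡_ embed
    preserves : Adj H =[ embed ]⇒ Adj G

open Copy public

_∈E_ : ∀ {k n} {H : Graph k} {G : Graph n} → VertexPair n → Copy H G → Set
_∈E_ {H = H} (u , v) c = ∃[ x ] ∃[ y ] Adj H x y × embed c x ≡ u × embed c y ≡ v

-- A pair (u , u) in the list contributes no edge, which keeps the result simple.
_∪_ : ∀ {n} → Graph n → List (VertexPair n) → Graph n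
G ∪ es = record
  { Adj        = λ u v → Adj G u v ⊎ (u ≢ v × ((u , v) ∈ es ⊎ (v , u) ∈ es))
  ; adj?       = λ u v → adj? G u v ⊎-dec (¬? (u ≟ v) ×-dec (((u , v) ∈? es) ⊎-dec ((v , u) ∈? es)))
  ; adj-sym    = Sum.map (adj-sym G) λ (u≢v , m) → ≢-sym u≢v , Sum.swap m
  ; adj-irrefl = λ { u≡v (inj₁ uv) → adj-irrefl G u≡v uv
                   ; u≡v (inj₂ (u≢v , _)) → u≢v u≡v }
  }

IsOrderingOfMissingEdges : ∀ {n} → Graph n → Graph n → List (VertexPair n) → Set
IsOrderingOfMissingEdges F G es =
  Unique es × (∀ e → e ∈ es ⇔ (e ∈ edges F × e ∉ edges G))

record WeaklySaturated {n k} (F : Graph n) (H : Graph k) (G : Graph n) : Set where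
  field
    spanning : SpanningSubgraph G F
    H-free   : ¬ Copy H G
    order    : List (VertexPair n)
    ordering : IsOrderingOfMissingEdges F G order
    -- i counts from 0, so stage i is G together with the first i + 1 edges.
    creates  : ∀ (i : Fin (length order)) →
               Σ[ c ∈ Copy H (G ∪ take (suc (toℕ i)) order) ] lookup order i ∈E c

-- IsWsat F H m says wsat(F , H) = m.
record IsWsat {n k} (F : Graph n) (H : Graph k) (m : ℕ) : Set₁ where
  field
    attained : Σ[ G ∈ Graph n ] WeaklySaturated F H G × edgeCount G ≡ m
    minimal  : ∀ G → WeaklySaturated F H G → m ≤ edgeCount G

{-# OPTIONS --safe #-}

-- Put r = s − 1, d = t − 1, and let z_u = (1 , u , … , u^(d−1)).  A pair (S , P) of a symmetric
-- d × d matrix S and polynomials P_u of degree < r, with P_u = 0 for the first d vertices, weighs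
-- the edge uv by S(z_u , z_v) + P_u(v) + P_v(u).  These pairs form a space whose dimension
-- C(t,2) + (s−1)(n−t+1) is the claimed bound.  In a copy of K_{s,t} there are nowhere-zero a and b on
-- the two parts which annihilate the polynomials of degree < r and < d respectively, so
-- Σ a_u b_v weight(uv) = 0 and the weight of one edge of the copy is determined by the others.
-- If G had fewer edges than the dimension, a nonzero (S , P) would vanish on E(G), hence on all of
-- K_n; but then, because n ≥ 3d, S = 0 and P = 0.
module Submission where

open import Defs
open import Data.Bool.Base using (if_then_else_)
open import Data.Fin.Base using (Fin; zero; suc; toℕ; fromℕ<; inject≤; punchIn; punchOut; splitAt; join; _↑ˡ_; _↑ʳ_)
import Data.Fin.Properties as Fin
open import Data.Integer.Base as ℤ using (ℤ; 0ℤ; 1ℤ)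
import Data.Integer.Properties as ℤ
open import Data.List.Base using (List; length; take; lookup; _∷ʳ_)
open import Data.List.Membership.Propositional.Properties using (∈-filter⁺; ∈-cartesianProduct⁺; ∈-allFin; ∈-++⁻)
open import Data.List.Properties using (take-suc; take-all)
open import Data.List.Relation.Unary.Any using (here; index)
open import Data.List.Relation.Unary.Any.Properties using (lookup-index)
open import Data.Nat.Base as ℕ using (ℕ; zero; suc; s≤s; z≤n; s<s)
open import Data.Nat.Combinatorics using (_C_; nC1≡n; nCk+nC[k+1]≡[n+1]C[k+1])
import Data.Nat.Properties as ℕ
import Algebra.Properties.Semiring.Sum ℕ.+-*-semiring as ℕΣ
open import Data.Product.Base using (Σ; ∃; _×_; _,_; proj₁; proj₂)
open import Data.Sum.Base as Sum using (_⊎_; inj₁; inj₂; [_,_]′)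
open import Data.Sum.Function.Propositional using (_⊎-↔_)
open import Data.Unit.Base using (tt)
open import Data.Vec.Functional using (insertAt; removeAt)
open import Data.Vec.Functional.Properties using (insertAt-lookup; insertAt-punchIn)
open import Function.Base using (_∘_; const; flip)
open import Function.Bundles using (_↔_; mk↔ₛ′; module Equivalence; module Inverse)
open import Function.Construct.Composition using (_↔-∘_)
open import Function.Construct.Identity using (↔-id)
open import Function.Definitions using (Injective)
open import Relation.Binary.Definitions using (tri<; tri≈; tri>)
open import Relation.Binary.PropositionalEquality
open import Relation.Nullary using (¬_; yes; no; does; contradiction)
open import Relation.Nullary.Decidable using (_×-dec_; dec-true; dec-false)

module LinearAlgebra where
  open import Algebra.Properties.Semiring.Sum ℤ.+-*-semiring
    using (sum; sum-syntax; sum-cong-≗; sum-replicate-zero; sum-remove;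
           ∑-distrib-+; ∑-comm; *-distribˡ-sum; *-distribʳ-sum)
  open import Data.Integer.Base using (_+_; _*_; _-_; -_; _^_)
  open import Data.Integer.Tactic.RingSolver using (solve-∀)
  open Inverse using (to)
  open ≡-Reasoning

  -- Finite sums of integers

  *-cancel-≢0 : ∀ {x y} → x ≢ 0ℤ → x * y ≡ 0ℤ → y ≡ 0ℤ
  *-cancel-≢0 {x} x≢0 xy≡0 with ℤ.i*j≡0⇒i≡0∨j≡0 x xy≡0
  ... | inj₁ x≡0 = contradiction x≡0 x≢0
  ... | inj₂ y≡0 = y≡0

  sum-zero : ∀ {n} {f : Fin n → ℤ} → (∀ i → f i ≡ 0ℤ) → sum f ≡ 0ℤ
  sum-zero {n} f≡0 = trans (sum-cong-≗ f≡0) (sum-replicate-zero n)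

  sum-single : ∀ {n} (f : Fin n → ℤ) i → (∀ j → j ≢ i → f j ≡ 0ℤ) → sum f ≡ f i
  sum-single {suc n} f i f≡0 = begin
    sum f                        ≡⟨ sum-remove f ⟩
    f i + sum (removeAt f i)     ≡⟨ cong (f i +_) (sum-zero λ j → f≡0 (punchIn i j) (Fin.punchInᵢ≢i i j)) ⟩
    f i + 0ℤ                     ≡⟨ ℤ.+-identityʳ (f i) ⟩
    f i                          ∎

  δ : ∀ {n} → Fin n → Fin n → ℤ
  δ i j = if does (i Fin.≟ j) then 1ℤ else 0ℤ

  δ-diag : ∀ {n} (i : Fin n) → δ i i ≡ 1ℤ
  δ-diag i = cong (if_then 1ℤ else 0ℤ) (dec-true (i Fin.≟ i) refl)

  δ-off : ∀ {n} {i j : Fin n} → i ≢ j → δ i j ≡ 0ℤ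
  δ-off {i = i} {j} i≢j = cong (if_then 1ℤ else 0ℤ) (dec-false (i Fin.≟ j) i≢j)

  sum-δ : ∀ {n} (f : Fin n → ℤ) j → ∑[ i < n ] (f i * δ i j) ≡ f j
  sum-δ f j = trans
    (sum-single (λ i → f i * δ i j) j λ i i≢j → trans (cong (f i *_) (δ-off i≢j)) (ℤ.*-zeroʳ (f i)))
    (trans (cong (f j *_) (δ-diag j)) (ℤ.*-identityʳ (f j)))

  -- Exchanging the order of summation lets an annihilation in one index be used under a linear
  -- combination in the other; the duality arguments below rest on this.
  sum-transpose : ∀ {m n} (b : Fin m → ℤ) (c : Fin n → ℤ) (a : Fin m → Fin n → ℤ) →
    ∑[ i < m ] (b i * (∑[ k < n ] (c k * a i k))) ≡ ∑[ k < n ] (c k * (∑[ i < m ] (b i * a i k)))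
  sum-transpose {m} {n} b c a = begin
    ∑[ i < m ] (b i * (∑[ k < n ] (c k * a i k)))
      ≡⟨ sum-cong-≗ (λ i → *-distribˡ-sum (b i) (λ k → c k * a i k)) ⟩
    ∑[ i < m ] (∑[ k < n ] (b i * (c k * a i k)))
      ≡⟨ ∑-comm (λ i k → b i * (c k * a i k)) ⟩
    ∑[ k < n ] (∑[ i < m ] (b i * (c k * a i k)))
      ≡⟨ sum-cong-≗ (λ k → sum-cong-≗ (λ i → swap (b i) (c k) (a i k))) ⟩
    ∑[ k < n ] (∑[ i < m ] (c k * (b i * a i k)))
      ≡⟨ sum-cong-≗ (λ k → *-distribˡ-sum (c k) (λ i → b i * a i k)) ⟨
    ∑[ k < n ] (c k * (∑[ i < m ] (b i * a i k))) ∎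
    where
    swap : ∀ x y z → x * (y * z) ≡ y * (x * z)
    swap = solve-∀

  -- Homogeneous linear systems over the integers

  -- Fraction-free Gaussian elimination on the first equation.
  underdetermined : ∀ {m N} → m ℕ.< N → (a : Fin m → Fin N → ℤ) →
    ∃ λ (c : Fin N → ℤ) → (∃ λ i → c i ≢ 0ℤ) × (∀ e → ∑[ i < N ] (c i * a e i) ≡ 0ℤ)
  underdetermined {zero} {suc N} _ a = (λ _ → 1ℤ) , (zero , λ ()) , λ ()
  underdetermined {suc m} {suc N} (s<s m<N) a with Fin.all? (λ i → a zero i ℤ.≟ 0ℤ)
  ... | yes a₀≡0 =
    let c , c≢0 , ker = underdetermined (ℕ.m<n⇒m<1+n m<N) (a ∘ suc)
    in c , c≢0 , λ { zero    → sum-zero λ i → trans (cong (c i *_) (a₀≡0 i)) (ℤ.*-zeroʳ (c i))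
                   ; (suc e) → ker e }
  ... | no  a₀≢0 = c , (punchIn p i , c≢0) , ker
    where
    pivot : ∃ λ i → a zero i ≢ 0ℤ
    pivot = Fin.¬∀⟶∃¬ (suc N) _ (λ i → a zero i ℤ.≟ 0ℤ) a₀≢0
    p = proj₁ pivot
    π = a zero p
    reduced : ∃ λ (c : Fin N → ℤ) → (∃ λ i → c i ≢ 0ℤ) ×
      (∀ e → ∑[ i < N ] (c i * (π * a (suc e) (punchIn p i) - a (suc e) p * a zero (punchIn p i))) ≡ 0ℤ)
    reduced = underdetermined m<N _
    c′ = proj₁ reduced
    i = proj₁ (proj₁ (proj₂ reduced))
    row : Fin (suc m) → ℤ
    row e = ∑[ j < N ] (c′ j * a e (punchIn p j))
    -- Scaling the other coordinates by `π` and giving the pivot the coordinate `- row zero` solves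
    -- the first equation without a division.
    c : Fin (suc N) → ℤ
    c = insertAt (λ j → π * c′ j) p (- row zero)
    c≢0 : c (punchIn p i) ≢ 0ℤ
    c≢0 eq = proj₂ (proj₁ (proj₂ reduced))
      (*-cancel-≢0 (proj₂ pivot) (trans (sym (insertAt-punchIn _ p _ i)) eq))
    expand : ∀ e → ∑[ j < suc N ] (c j * a e j) ≡ π * row e - a e p * row zero
    expand e = begin
      ∑[ j < suc N ] (c j * a e j)
        ≡⟨ sum-remove {i = p} (λ j → c j * a e j) ⟩
      c p * a e p + ∑[ j < N ] (c (punchIn p j) * a e (punchIn p j))
        ≡⟨ cong₂ _+_ (cong (_* a e p) (insertAt-lookup (λ j → π * c′ j) p _))
                     (sum-cong-≗ λ j → trans (cong (_* a e (punchIn p j)) (insertAt-punchIn (λ j → π * c′ j) p _ j))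
                                              (ℤ.*-assoc π (c′ j) _)) ⟩
      (- row zero) * a e p + ∑[ j < N ] (π * (c′ j * a e (punchIn p j)))
        ≡⟨ cong ((- row zero) * a e p +_) (*-distribˡ-sum π (λ j → c′ j * a e (punchIn p j))) ⟨
      (- row zero) * a e p + π * row e
        ≡⟨ rearrange (row zero) (a e p) π (row e) ⟩
      π * row e - a e p * row zero ∎
      where
      rearrange : ∀ r x π s → (- r) * x + π * s ≡ π * s - x * r
      rearrange = solve-∀
    ker : ∀ e → ∑[ j < suc N ] (c j * a e j) ≡ 0ℤ
    ker zero    = trans (expand zero) (ℤ.+-inverseʳ (π * row zero))
    ker (suc e) = begin
      ∑[ j < suc N ] (c j * a (suc e) j)
        ≡⟨ expand (suc e) ⟩
      π * row (suc e) - x * row zero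
        ≡⟨ cong (π * row (suc e) +_) (ℤ.neg-distribˡ-* x (row zero)) ⟩
      π * row (suc e) + (- x) * row zero
        ≡⟨ cong₂ _+_ (*-distribˡ-sum π (λ j → c′ j * y j)) (*-distribˡ-sum (- x) (λ j → c′ j * z j)) ⟩
      ∑[ j < N ] (π * (c′ j * y j)) + ∑[ j < N ] ((- x) * (c′ j * z j))
        ≡⟨ ∑-distrib-+ (λ j → π * (c′ j * y j)) (λ j → (- x) * (c′ j * z j)) ⟨
      ∑[ j < N ] (π * (c′ j * y j) + (- x) * (c′ j * z j))
        ≡⟨ sum-cong-≗ (λ j → collect π (c′ j) (y j) x (z j)) ⟩
      ∑[ j < N ] (c′ j * (π * y j - x * z j))
        ≡⟨ proj₂ (proj₂ reduced) e ⟩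
      0ℤ ∎
      where
      x = a (suc e) p
      y z : Fin N → ℤ
      y j = a (suc e) (punchIn p j)
      z j = a zero (punchIn p j)
      collect : ∀ π c y x z → π * (c * y) + (- x) * (c * z) ≡ c * (π * y - x * z)
      collect = solve-∀

  -- Moment annihilators and polynomial interpolation

  Annihilates : ∀ {n} → (Fin n → ℤ) → (Fin n → ℤ) → ℕ → Set
  Annihilates {n} b x d = ∀ k → k ℕ.< d → ∑[ i < n ] (b i * x i ^ k) ≡ 0ℤ

  annihilates : ∀ {n d} (b x : Fin n → ℤ) →
    (∀ (k : Fin d) → ∑[ i < n ] (b i * x i ^ toℕ k) ≡ 0ℤ) → Annihilates b x d
  annihilates {n} b x ann k k<d =
    subst (λ h → ∑[ i < n ] (b i * x i ^ h) ≡ 0ℤ) (Fin.toℕ-fromℕ< k<d) (ann (fromℕ< k<d))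

  -- Multiplying the i-th coefficient by x i - x 0 loses one degree and one point.
  vandermonde : ∀ {d} (x b : Fin d → ℤ) → Injective _≡_ _≡_ x → Annihilates b x d → ∀ i → b i ≡ 0ℤ
  vandermonde {suc d} x b x-inj ann = λ { zero → head≡0 ; (suc i) → tail≡0 i }
    where
    b′ : Fin d → ℤ
    b′ i = b (suc i) * (x (suc i) - x zero)
    ann′ : Annihilates b′ (x ∘ suc) d
    ann′ k k<d = begin
      ∑[ i < d ] (b′ i * x (suc i) ^ k)
        ≡⟨ ℤ.+-identityˡ _ ⟨
      0ℤ + ∑[ i < d ] (b′ i * x (suc i) ^ k)
        -- The index `zero` has the factor `x zero - x zero`, so including it changes nothing, and
        -- the moments of `b` over all the points can be used.
        ≡⟨ cong (_+ ∑[ i < d ] (b′ i * x (suc i) ^ k)) (vanish (b zero) (x zero) (x zero ^ k)) ⟨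
      ∑[ i < suc d ] (b i * (x i - x zero) * x i ^ k)
        ≡⟨ sum-cong-≗ (λ i → split (b i) (x i) (x zero) (x i ^ k)) ⟩
      ∑[ i < suc d ] (b i * x i ^ suc k + (- x zero) * (b i * x i ^ k))
        ≡⟨ ∑-distrib-+ (λ i → b i * x i ^ suc k) (λ i → (- x zero) * (b i * x i ^ k)) ⟩
      ∑[ i < suc d ] (b i * x i ^ suc k) + ∑[ i < suc d ] ((- x zero) * (b i * x i ^ k))
        ≡⟨ cong₂ _+_ (ann (suc k) (s<s k<d)) (sym (*-distribˡ-sum (- x zero) (λ i → b i * x i ^ k))) ⟩
      0ℤ + (- x zero) * (∑[ i < suc d ] (b i * x i ^ k))
        ≡⟨ cong (λ s → 0ℤ + (- x zero) * s) (ann k (ℕ.m<n⇒m<1+n k<d)) ⟩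
      0ℤ + (- x zero) * 0ℤ
        ≡⟨ trans (ℤ.+-identityˡ _) (ℤ.*-zeroʳ (- x zero)) ⟩
      0ℤ ∎
      where
      vanish : ∀ b x y → b * (x - x) * y ≡ 0ℤ
      vanish b x y = trans (cong (λ z → b * z * y) (ℤ.+-inverseʳ x)) (cong (_* y) (ℤ.*-zeroʳ b))
      split : ∀ b x x₀ y → b * (x - x₀) * y ≡ b * (x * y) + (- x₀) * (b * y)
      split = solve-∀
    tail≡0 : ∀ i → b (suc i) ≡ 0ℤ
    tail≡0 i = *-cancel-≢0 x≢x₀ (trans (ℤ.*-comm (x (suc i) - x zero) (b (suc i)))
      (vandermonde (x ∘ suc) b′ (Fin.suc-injective ∘ x-inj) ann′ i))
      where
      x≢x₀ : x (suc i) - x zero ≢ 0ℤ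
      x≢x₀ eq with () ← x-inj (ℤ.i-j≡0⇒i≡j (x (suc i)) (x zero) eq)
    -- Once the tail vanishes, the moment of degree 0 is `b zero` alone.
    head≡0 : b zero ≡ 0ℤ
    head≡0 = begin
      b zero                               ≡⟨ ℤ.*-identityʳ (b zero) ⟨
      b zero * 1ℤ                          ≡⟨ sum-single (λ i → b i * 1ℤ) zero
                                                (λ { zero 0≢0 → contradiction refl 0≢0
                                                   ; (suc i) _ → cong (_* 1ℤ) (tail≡0 i) }) ⟨
      ∑[ i < suc d ] (b i * x i ^ 0)       ≡⟨ ann 0 (s≤s z≤n) ⟩
      0ℤ                                   ∎

  -- There are `d` equations in `suc d` unknowns, hence a nontrivial solution. If one coordinate
  -- were zero, the others would annihilate degrees below `d` on `d` distinct points and so vanish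
  -- by `vandermonde`.
  nowhere-zero-annihilator : ∀ {d} (x : Fin (suc d) → ℤ) → Injective _≡_ _≡_ x →
    ∃ λ b → (∀ i → b i ≢ 0ℤ) × Annihilates b x d
  nowhere-zero-annihilator {d} x x-inj = b , nowhere-zero , ann
    where
    solution = underdetermined (ℕ.n<1+n d) (λ k i → x i ^ toℕ k)
    b = proj₁ solution
    i₀ = proj₁ (proj₁ (proj₂ solution))
    ann : Annihilates b x d
    ann = annihilates b x (proj₂ (proj₂ solution))
    nowhere-zero : ∀ i → b i ≢ 0ℤ
    nowhere-zero j bj≡0 = proj₂ (proj₁ (proj₂ solution)) bi₀≡0
      where
      others : ∀ i → b (punchIn j i) ≡ 0ℤ
      others = vandermonde (x ∘ punchIn j) (b ∘ punchIn j) (Fin.punchIn-injective j _ _ ∘ x-inj) λ k k<d → begin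
        rest k                        ≡⟨ ℤ.+-identityˡ _ ⟨
        0ℤ + rest k                   ≡⟨ cong (λ z → z * x j ^ k + rest k) bj≡0 ⟨
        b j * x j ^ k + rest k        ≡⟨ sum-remove (λ i → b i * x i ^ k) ⟨
        ∑[ i < suc d ] (b i * x i ^ k) ≡⟨ ann k k<d ⟩
        0ℤ                            ∎
        where
        rest : ℕ → ℤ
        rest k = ∑[ i < d ] (b (punchIn j i) * x (punchIn j i) ^ k)
      bi₀≡0 : b i₀ ≡ 0ℤ
      bi₀≡0 with j Fin.≟ i₀
      ... | yes refl = bj≡0
      ... | no  j≢i₀ = trans (cong b (sym (Fin.punchIn-punchOut j≢i₀))) (others (punchOut j≢i₀))

  eval : ∀ {d} → (Fin d → ℤ) → ℤ → ℤ
  eval {d} c x = ∑[ k < d ] (c k * x ^ toℕ k)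

  annihilates-eval : ∀ {n d} (b x : Fin n → ℤ) → Annihilates b x d → (c : Fin d → ℤ) →
    ∑[ i < n ] (b i * eval c (x i)) ≡ 0ℤ
  annihilates-eval b x ann c = trans (sum-transpose b c (λ i k → x i ^ toℕ k))
    (sum-zero λ k → trans (cong (c k *_) (ann (toℕ k) (Fin.toℕ<n k))) (ℤ.*-zeroʳ (c k)))

  -- A nontrivial solution (β , b) of β eⱼ + Σ bᵢ (xᵢᵏ)ₖ = 0 has β ≠ 0 by vandermonde;
  -- pairing it with c leaves β cⱼ = 0.
  vanishing-coefficients : ∀ {d} (x : Fin d → ℤ) → Injective _≡_ _≡_ x →
    (c : Fin d → ℤ) → (∀ i → eval c (x i) ≡ 0ℤ) → ∀ j → c j ≡ 0ℤ
  vanishing-coefficients {d} x x-inj c vanish j = *-cancel-≢0 β≢0 (begin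
    β * c j
      ≡⟨ cong (β *_) (sum-δ c j) ⟨
    β * cδ
      ≡⟨ ℤ.+-identityʳ _ ⟨
    β * cδ + 0ℤ
      ≡⟨ cong (β * cδ +_) (sum-zero λ i → trans (cong (b i *_) (vanish i)) (ℤ.*-zeroʳ (b i))) ⟨
    ∑[ i < suc d ] (proj₁ solution i * (∑[ k < d ] (c k * a k i)))
      ≡⟨ sum-transpose (proj₁ solution) c (λ i k → a k i) ⟩
    ∑[ k < d ] (c k * (∑[ i < suc d ] (proj₁ solution i * a k i)))
      ≡⟨ sum-zero (λ k → trans (cong (c k *_) (proj₂ (proj₂ solution) k)) (ℤ.*-zeroʳ (c k))) ⟩
    0ℤ ∎)
    where
    cδ = ∑[ k < d ] (c k * δ k j)
    a : Fin d → Fin (suc d) → ℤ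
    a k zero    = δ k j
    a k (suc i) = x i ^ toℕ k
    solution = underdetermined (ℕ.n<1+n d) a
    β = proj₁ solution zero
    b = proj₁ solution ∘ suc
    β≢0 : β ≢ 0ℤ
    β≢0 β≡0 = proj₂ (proj₁ (proj₂ solution)) (all≡0 _)
      where
      b≡0 : ∀ i → b i ≡ 0ℤ
      b≡0 = vandermonde x b x-inj (annihilates b x λ k → begin
        ∑[ i < d ] (b i * x i ^ toℕ k)             ≡⟨ ℤ.+-identityˡ _ ⟨
        0ℤ + ∑[ i < d ] (b i * x i ^ toℕ k)        ≡⟨ cong (λ z → z * δ k j + ∑[ i < d ] (b i * x i ^ toℕ k)) β≡0 ⟨
        β * δ k j + ∑[ i < d ] (b i * x i ^ toℕ k)   ≡⟨ proj₂ (proj₂ solution) k ⟩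
        0ℤ ∎)
      all≡0 : ∀ i → proj₁ solution i ≡ 0ℤ
      all≡0 zero    = β≡0
      all≡0 (suc i) = b≡0 i

  -- Systems whose unknowns form rows of varying length

  sum-splitAt : ∀ a {b} (f : Fin a ⊎ Fin b → ℤ) →
    ∑[ x < a ℕ.+ b ] f (splitAt a x) ≡ ∑[ i < a ] f (inj₁ i) + ∑[ j < b ] f (inj₂ j)
  sum-splitAt zero    f = sym (ℤ.+-identityˡ _)
  sum-splitAt (suc a) f = trans (cong (f (inj₁ zero) +_) (sum-splitAt a (f ∘ Sum.map₁ suc)))
    (sym (ℤ.+-assoc (f (inj₁ zero)) _ _))

  first-or-later : ∀ {r} (w : Fin (suc r) → ℕ) →
    (Fin (w zero) ⊎ Σ (Fin r) (Fin ∘ w ∘ suc)) ↔ Σ (Fin (suc r)) (Fin ∘ w)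
  first-or-later w = mk↔ₛ′
    (λ { (inj₁ j) → zero , j ; (inj₂ (i , j)) → suc i , j })
    (λ { (zero , j) → inj₁ j ; (suc i , j) → inj₂ (i , j) })
    (λ { (zero , j) → refl   ; (suc i , j) → refl })
    (λ { (inj₁ j) → refl     ; (inj₂ _) → refl })

  -- Flattening the rows makes `underdetermined` applicable, with the total width as the number of
  -- unknowns.
  ragged : ∀ {r} (w : Fin r → ℕ) → Fin (ℕΣ.sum w) ↔ Σ (Fin r) (Fin ∘ w)
  ragged {zero}  w = mk↔ₛ′ (λ ()) (λ ()) (λ ()) (λ ())
  ragged {suc r} w = first-or-later w ↔-∘ ((↔-id _ ⊎-↔ ragged (w ∘ suc)) ↔-∘ Fin.+↔⊎)

  sum-ragged : ∀ {r} (w : Fin r → ℕ) (f : Σ (Fin r) (Fin ∘ w) → ℤ) →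
    sum (f ∘ to (ragged w)) ≡ ∑[ i < r ] (∑[ j < w i ] f (i , j))
  sum-ragged {zero}  w f = refl
  sum-ragged {suc r} w f = trans (sum-splitAt (w zero) (f ∘ to (first-or-later w) ∘ Sum.map₂ (to (ragged (w ∘ suc)))))
    (cong (∑[ j < w zero ] f (zero , j) +_) (sum-ragged (w ∘ suc) (λ (i , j) → f (suc i , j))))

  -- The first family will hold the entries of the symmetric matrix, the second the coefficients of
  -- the vertex polynomials, so the two sums of widths add up to the dimension of the space of
  -- weights.
  underdetermined-ragged : ∀ {m r r′} (w : Fin r → ℕ) (w′ : Fin r′ → ℕ) →
    m ℕ.< ℕΣ.sum w ℕ.+ ℕΣ.sum w′ →
    (a : Fin m → ∀ i → Fin (w i) → ℤ) (a′ : Fin m → ∀ i → Fin (w′ i) → ℤ) →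
    ∃ λ (c : ∀ i → Fin (w i) → ℤ) → ∃ λ (c′ : ∀ i → Fin (w′ i) → ℤ) →
      ¬ ((∀ i j → c i j ≡ 0ℤ) × (∀ i j → c′ i j ≡ 0ℤ)) ×
      (∀ e → ∑[ i < r ] (∑[ j < w i ] (c i j * a e i j)) +
             ∑[ i < r′ ] (∑[ j < w′ i ] (c′ i j * a′ e i j)) ≡ 0ℤ)
  underdetermined-ragged {m} {r} {r′} w w′ m<N a a′ = c , c′ , nonzero , ker
    where
    module W  = Inverse (ragged w)
    module W′ = Inverse (ragged w′)
    N  = ℕΣ.sum w
    N′ = ℕΣ.sum w′
    Index : Set
    Index = Fin N ⊎ Fin N′
    coeff : Fin m → Index → ℤ
    coeff e (inj₁ x) = let i , j = W.to x in a e i j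
    coeff e (inj₂ y) = let i , j = W′.to y in a′ e i j
    solution = underdetermined m<N (λ e x → coeff e (splitAt N x))
    γ : Index → ℤ
    γ = proj₁ solution ∘ join N N′
    c : ∀ i → Fin (w i) → ℤ
    c i j = γ (inj₁ (W.from (i , j)))
    c′ : ∀ i → Fin (w′ i) → ℤ
    c′ i j = γ (inj₂ (W′.from (i , j)))
    nonzero : ¬ ((∀ i j → c i j ≡ 0ℤ) × (∀ i j → c′ i j ≡ 0ℤ))
    nonzero (c≡0 , c′≡0) =
      let (x , γ≢0) , _ = proj₂ solution
      in γ≢0 (trans (cong (proj₁ solution) (sym (Fin.join-splitAt N N′ x))) (γ≡0 (splitAt N x)))
      where
      γ≡0 : ∀ x → γ x ≡ 0ℤ
      γ≡0 (inj₁ x) = trans (cong (γ ∘ inj₁) (sym (W.strictlyInverseʳ x))) (c≡0 _ _)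
      γ≡0 (inj₂ y) = trans (cong (γ ∘ inj₂) (sym (W′.strictlyInverseʳ y))) (c′≡0 _ _)
    ker : ∀ e → ∑[ i < r ] (∑[ j < w i ] (c i j * a e i j)) +
                ∑[ i < r′ ] (∑[ j < w′ i ] (c′ i j * a′ e i j)) ≡ 0ℤ
    ker e = begin
      ∑[ i < r ] (∑[ j < w i ] (c i j * a e i j)) + ∑[ i < r′ ] (∑[ j < w′ i ] (c′ i j * a′ e i j))
        ≡⟨ cong₂ _+_ (sum-ragged w (λ (i , j) → c i j * a e i j)) (sum-ragged w′ (λ (i , j) → c′ i j * a′ e i j)) ⟨
      ∑[ x < N ] (γ (inj₁ (W.from (W.to x))) * coeff e (inj₁ x)) +
      ∑[ y < N′ ] (γ (inj₂ (W′.from (W′.to y))) * coeff e (inj₂ y))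
        ≡⟨ cong₂ _+_ (sum-cong-≗ λ x → cong (λ z → γ (inj₁ z) * coeff e (inj₁ x)) (W.strictlyInverseʳ x))
                     (sum-cong-≗ λ y → cong (λ z → γ (inj₂ z) * coeff e (inj₂ y)) (W′.strictlyInverseʳ y)) ⟩
      ∑[ x < N ] (γ (inj₁ x) * coeff e (inj₁ x)) + ∑[ y < N′ ] (γ (inj₂ y) * coeff e (inj₂ y))
        ≡⟨ sum-splitAt N (λ x → γ x * coeff e x) ⟨
      ∑[ x < N ℕ.+ N′ ] (γ (splitAt N x) * coeff e (splitAt N x))
        ≡⟨ sum-cong-≗ (λ x → cong (λ z → proj₁ solution z * coeff e (splitAt N x)) (Fin.join-splitAt N N′ x)) ⟩
      ∑[ x < N ℕ.+ N′ ] (proj₁ solution x * coeff e (splitAt N x))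
        ≡⟨ proj₂ (proj₂ solution) e ⟩
      0ℤ ∎

  -- Zero-padded coefficients, polynomials and bilinear forms

  pad : ∀ {a} → (Fin a → ℤ) → ℕ → ℤ
  pad {zero}  f l       = 0ℤ
  pad {suc a} f zero    = f zero
  pad {suc a} f (suc l) = pad (f ∘ suc) l

  pad-toℕ : ∀ {a} (f : Fin a → ℤ) j → pad f (toℕ j) ≡ f j
  pad-toℕ f zero    = refl
  pad-toℕ f (suc j) = pad-toℕ (f ∘ suc) j

  pad-beyond : ∀ {a} (f : Fin a → ℤ) {l} → a ℕ.≤ l → pad f l ≡ 0ℤ
  pad-beyond {zero}  f a≤l       = refl
  pad-beyond {suc a} f (s≤s a≤l) = pad-beyond (f ∘ suc) a≤l

  sum-pad : ∀ {a d} → a ℕ.≤ d → (f : Fin a → ℤ) (y : ℕ → ℤ) →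
    ∑[ l < d ] (pad f (toℕ l) * y (toℕ l)) ≡ ∑[ j < a ] (f j * y (toℕ j))
  sum-pad {d = d} z≤n f y = sum-zero {d} λ l → ℤ.*-zeroˡ (y (toℕ l))
  sum-pad (s≤s a≤d) f y = cong (f zero * y 0 +_) (sum-pad a≤d (f ∘ suc) (y ∘ suc))

  eval-+ : ∀ {d} (c c′ : Fin d → ℤ) x → eval (λ k → c k + c′ k) x ≡ eval c x + eval c′ x
  eval-+ c c′ x = trans (sum-cong-≗ λ k → ℤ.*-distribʳ-+ (x ^ toℕ k) (c k) (c′ k))
    (∑-distrib-+ (λ k → c k * x ^ toℕ k) (λ k → c′ k * x ^ toℕ k))

  eval-zero : ∀ {d} {c : Fin d → ℤ} → (∀ k → c k ≡ 0ℤ) → ∀ x → eval c x ≡ 0ℤ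
  eval-zero c≡0 x = sum-zero λ k → trans (cong (_* x ^ toℕ k) (c≡0 k)) (ℤ.*-zeroˡ (x ^ toℕ k))

  -- This is the value of the bilinear form of `S` at the moment vectors `(1 , x , … , x^(d−1))` and
  -- `(1 , y , … , y^(d−1))`, nested so that for fixed `y` it is visibly a polynomial in `x`.
  form : ∀ {d} → (Fin d → Fin d → ℤ) → ℤ → ℤ → ℤ
  form S x y = eval (λ k → eval (S k) y) x

  form-flip : ∀ {d} (S : Fin d → Fin d → ℤ) x y → form S x y ≡ form (flip S) y x
  form-flip {d} S x y = begin
    ∑[ k < d ] ((∑[ l < d ] (S k l * y ^ toℕ l)) * x ^ toℕ k)
      ≡⟨ sum-cong-≗ (λ k → trans (ℤ.*-comm _ (x ^ toℕ k))
           (cong (x ^ toℕ k *_) (sum-cong-≗ λ l → ℤ.*-comm (S k l) _))) ⟩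
    ∑[ k < d ] (x ^ toℕ k * (∑[ l < d ] (y ^ toℕ l * S k l)))
      ≡⟨ sum-transpose (λ k → x ^ toℕ k) (λ l → y ^ toℕ l) S ⟩
    ∑[ l < d ] (y ^ toℕ l * (∑[ k < d ] (x ^ toℕ k * S k l)))
      ≡⟨ sum-cong-≗ (λ l → trans (ℤ.*-comm (y ^ toℕ l) _)
           (cong (_* y ^ toℕ l) (sum-cong-≗ λ k → ℤ.*-comm _ (S k l)))) ⟩
    ∑[ l < d ] ((∑[ k < d ] (S k l * x ^ toℕ k)) * y ^ toℕ l) ∎

  sum-const : ∀ m r → ℕΣ.sum {m} (const r) ≡ m ℕ.* r
  sum-const zero    r = refl
  sum-const (suc m) r = cong (r ℕ.+_) (sum-const m r)

  sum-triangle : ∀ d → ℕΣ.sum {d} (suc ∘ toℕ) ≡ suc d C 2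
  sum-triangle zero    = refl
  sum-triangle (suc d) = begin
    suc (ℕΣ.sum {d} (λ i → suc (suc (toℕ i))))      ≡⟨ cong suc (ℕΣ.∑-distrib-+ {d} (const 1) (suc ∘ toℕ)) ⟩
    suc (ℕΣ.sum {d} (const 1) ℕ.+ ℕΣ.sum {d} (suc ∘ toℕ))
      ≡⟨ cong₂ (λ a b → suc (a ℕ.+ b)) (trans (sum-const d 1) (ℕ.*-identityʳ d)) (sum-triangle d) ⟩
    suc d ℕ.+ suc d C 2                             ≡⟨ cong (ℕ._+ suc d C 2) (nC1≡n (suc d)) ⟨
    suc d C 1 ℕ.+ suc d C 2                         ≡⟨ nCk+nC[k+1]≡[n+1]C[k+1] (suc d) 1 ⟩
    suc (suc d) C 2 ∎

  -- Edge weights, their rigidity in copies and their faithfulness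

  pos : ∀ {n} → Fin n → ℤ
  pos u = ℤ.+ toℕ u

  pos-injective : ∀ {n} → Injective _≡_ _≡_ (pos {n})
  pos-injective = Fin.toℕ-injective ∘ ℤ.+-injective

  -- These are the coefficients of the polynomial `y ↦ form S y (pos u) + eval (P u) y`, which
  -- gathers everything in the weight of `uv` except `P_v(u)`.
  mixed : ∀ {n d} → (Fin d → Fin d → ℤ) → (Fin n → Fin d → ℤ) → Fin n → Fin d → ℤ
  mixed S P u k = eval (S k) (pos u) + P u k

  weight : ∀ {n d} → (Fin d → Fin d → ℤ) → (Fin n → Fin d → ℤ) → Fin n → Fin n → ℤ
  weight S P u v = form S (pos u) (pos v) + (eval (P u) (pos v) + eval (P v) (pos u))

  module _ {n d} (S : Fin d → Fin d → ℤ) (P : Fin n → Fin d → ℤ) (S-sym : ∀ k l → S k l ≡ S l k) where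

    form-comm : ∀ x y → form S x y ≡ form S y x
    form-comm x y = trans (form-flip S x y)
      (sum-cong-≗ λ l → cong (_* y ^ toℕ l) (sum-cong-≗ λ k → cong (_* x ^ toℕ k) (S-sym k l)))

    weight-comm : ∀ u v → weight S P u v ≡ weight S P v u
    weight-comm u v = cong₂ _+_ (form-comm (pos u) (pos v)) (ℤ.+-comm (eval (P u) (pos v)) _)

    -- The first summand is a polynomial in `v` of degree below `d`, the second a polynomial in `u`
    -- with the coefficients `P v`. Each can thus be annihilated, or interpolated, in one variable.
    weight-mixed : ∀ u v → weight S P u v ≡ eval (mixed S P u) (pos v) + eval (P v) (pos u)
    weight-mixed u v = begin
      form S (pos u) (pos v) + (eval (P u) (pos v) + eval (P v) (pos u))
        ≡⟨ ℤ.+-assoc (form S (pos u) (pos v)) _ _ ⟨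
      form S (pos u) (pos v) + eval (P u) (pos v) + eval (P v) (pos u)
        ≡⟨ cong (λ z → z + eval (P u) (pos v) + eval (P v) (pos u)) (form-comm (pos u) (pos v)) ⟩
      form S (pos v) (pos u) + eval (P u) (pos v) + eval (P v) (pos u)
        ≡⟨ cong (_+ eval (P v) (pos u)) (eval-+ (λ k → eval (S k) (pos u)) (P u) (pos v)) ⟨
      eval (mixed S P u) (pos v) + eval (P v) (pos u) ∎

    -- With a killing degrees < r on the α-side and b killing degrees < d on the β-side,
    -- both halves of weight-mixed vanish in Σ aᵢ bⱼ weight (αᵢ , βⱼ).
    weight-forced : ∀ {r} → (∀ v k → r ℕ.≤ toℕ k → P v k ≡ 0ℤ) →
      (α : Fin (suc r) → Fin n) (β : Fin (suc d) → Fin n) → Injective _≡_ _≡_ α → Injective _≡_ _≡_ β →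
      ∀ i j → (∀ i′ j′ → ¬ (i′ ≡ i × j′ ≡ j) → weight S P (α i′) (β j′) ≡ 0ℤ) →
      weight S P (α i) (β j) ≡ 0ℤ
    weight-forced {r} P-low α β α-inj β-inj i j others =
      -- By `others` the double sum reduces to its term at `(i , j)`, and the nonzero coefficients
      -- `a i` and `b j` cancel at the end.
      *-cancel-≢0 (proj₁ (proj₂ B) j) (*-cancel-≢0 (proj₁ (proj₂ A) i) (begin
        a i * (b j * w i j)
          ≡⟨ cong (a i *_) (sum-single (λ j′ → b j′ * w i j′) j
               λ j′ j′≢j → trans (cong (b j′ *_) (others i j′ (j′≢j ∘ proj₂))) (ℤ.*-zeroʳ (b j′))) ⟨
        a i * (∑[ j′ < suc d ] (b j′ * w i j′))
          ≡⟨ sum-single (λ i′ → a i′ * (∑[ j′ < suc d ] (b j′ * w i′ j′))) i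
               (λ i′ i′≢i → trans (cong (a i′ *_) (sum-zero λ j′ →
                  trans (cong (b j′ *_) (others i′ j′ (i′≢i ∘ proj₁))) (ℤ.*-zeroʳ (b j′))))
                  (ℤ.*-zeroʳ (a i′))) ⟨
        ∑[ i′ < suc r ] (a i′ * (∑[ j′ < suc d ] (b j′ * w i′ j′)))
          ≡⟨ sum-cong-≗ (λ i′ → cong (a i′ *_) (inner i′)) ⟩
        ∑[ i′ < suc r ] (a i′ * (∑[ j′ < suc d ] (b j′ * eval (P (β j′)) (pos (α i′)))))
          ≡⟨ sum-transpose a b (λ i′ j′ → eval (P (β j′)) (pos (α i′))) ⟩
        ∑[ j′ < suc d ] (b j′ * (∑[ i′ < suc r ] (a i′ * eval (P (β j′)) (pos (α i′)))))
          ≡⟨ sum-zero (λ j′ → trans (cong (b j′ *_) (outer (β j′))) (ℤ.*-zeroʳ (b j′))) ⟩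
        0ℤ ∎))
      where
      w : Fin (suc r) → Fin (suc d) → ℤ
      w i′ j′ = weight S P (α i′) (β j′)
      A = nowhere-zero-annihilator (pos ∘ α) (α-inj ∘ pos-injective)
      B = nowhere-zero-annihilator (pos ∘ β) (β-inj ∘ pos-injective)
      a = proj₁ A
      b = proj₁ B
      inner : ∀ i′ → ∑[ j′ < suc d ] (b j′ * w i′ j′) ≡ ∑[ j′ < suc d ] (b j′ * eval (P (β j′)) (pos (α i′)))
      inner i′ = begin
        ∑[ j′ < suc d ] (b j′ * w i′ j′)
          ≡⟨ sum-cong-≗ (λ j′ → trans (cong (b j′ *_) (weight-mixed (α i′) (β j′)))
               (ℤ.*-distribˡ-+ (b j′) (eval h (pos (β j′))) (eval (P (β j′)) (pos (α i′))))) ⟩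
        ∑[ j′ < suc d ] (b j′ * eval h (pos (β j′)) + b j′ * eval (P (β j′)) (pos (α i′)))
          ≡⟨ ∑-distrib-+ (λ j′ → b j′ * eval h (pos (β j′))) (λ j′ → b j′ * eval (P (β j′)) (pos (α i′))) ⟩
        ∑[ j′ < suc d ] (b j′ * eval h (pos (β j′))) + rest
          ≡⟨ cong (_+ rest) (annihilates-eval b (pos ∘ β) (proj₂ (proj₂ B)) h) ⟩
        0ℤ + rest
          ≡⟨ ℤ.+-identityˡ rest ⟩
        rest ∎
        where
        h = mixed S P (α i′)
        rest = ∑[ j′ < suc d ] (b j′ * eval (P (β j′)) (pos (α i′)))
      outer : ∀ v → ∑[ i′ < suc r ] (a i′ * eval (P v) (pos (α i′))) ≡ 0ℤ
      outer v = trans (sum-transpose a (P v) (λ i′ k → pos (α i′) ^ toℕ k)) (sum-zero term)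
        where
        term : ∀ k → P v k * (∑[ i′ < suc r ] (a i′ * pos (α i′) ^ toℕ k)) ≡ 0ℤ
        -- `P v` is stored with `d` coefficients although its degree is below `r`: for `k < r` the
        -- moment of `a` vanishes, for larger `k` the coefficient does.
        term k with toℕ k ℕ.<? r
        ... | yes k<r = trans (cong (P v k *_) (proj₂ (proj₂ A) (toℕ k) k<r)) (ℤ.*-zeroʳ (P v k))
        ... | no  k≮r = trans (cong (_* moment) (P-low v k (ℕ.≮⇒≥ k≮r))) (ℤ.*-zeroˡ moment)
          where
          moment = ∑[ i′ < suc r ] (a i′ * pos (α i′) ^ toℕ k)

  ↑ˡ≢↑ʳ : ∀ {a b} (i : Fin a) (j : Fin b) → i ↑ˡ b ≢ a ↑ʳ j
  ↑ˡ≢↑ʳ {a} {b} i j eq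
    with () ← trans (sym (Fin.splitAt-↑ˡ a i b)) (trans (cong (splitAt a) eq) (Fin.splitAt-↑ʳ a b j))

  -- On the first d vertices P vanishes, so weight ≡ 0 there makes the polynomial mixed S P v vanish
  -- for v ≥ d. Hence weight w v collapses to -form S w v for distinct v , w ≥ d, so form S vanishes on
  -- the product of two disjoint sets of d vertices.
  weight-faithful : ∀ d e (S : Fin d → Fin d → ℤ) (P : Fin (d ℕ.+ (d ℕ.+ (d ℕ.+ e))) → Fin d → ℤ) →
    (∀ k l → S k l ≡ S l k) → (∀ u k → P (u ↑ˡ _) k ≡ 0ℤ) →
    (∀ u v → u ≢ v → weight S P u v ≡ 0ℤ) →
    (∀ k l → S k l ≡ 0ℤ) × (∀ v k → P v k ≡ 0ℤ)
  weight-faithful d e S P S-sym P-head weight≡0 = S≡0 , P≡0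
    where
    m = d ℕ.+ (d ℕ.+ e)
    front : Fin d → Fin (d ℕ.+ m)
    front u = u ↑ˡ m
    back : Fin m → Fin (d ℕ.+ m)
    back v = d ↑ʳ v
    -- With `front` these make three disjoint blocks of `d` interpolation points; this is where
    -- `n ≥ 3d` enters.
    middle last : Fin d → Fin m
    middle i = i ↑ˡ (d ℕ.+ e)
    last i = d ↑ʳ (i ↑ˡ e)
    mixed≡0 : ∀ v k → mixed S P (back v) k ≡ 0ℤ
    mixed≡0 v = vanishing-coefficients (pos ∘ front) (Fin.↑ˡ-injective m _ _ ∘ pos-injective) _ λ u → begin
      eval (mixed S P (back v)) (pos (front u))
        ≡⟨ ℤ.+-identityʳ _ ⟨
      eval (mixed S P (back v)) (pos (front u)) + 0ℤ
        ≡⟨ cong (eval (mixed S P (back v)) (pos (front u)) +_) (eval-zero (P-head u) (pos (back v))) ⟨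
      eval (mixed S P (back v)) (pos (front u)) + eval (P (front u)) (pos (back v))
        ≡⟨ weight-mixed S P S-sym (back v) (front u) ⟨
      weight S P (back v) (front u)
        ≡⟨ weight≡0 (back v) (front u) (↑ˡ≢↑ʳ u v ∘ sym) ⟩
      0ℤ ∎
    form≡0 : ∀ v w → v ≢ w → form S (pos (back v)) (pos (back w)) ≡ 0ℤ
    form≡0 v w v≢w = begin
      form S x y
        ≡⟨ ℤ.+-identityʳ _ ⟨
      form S x y + 0ℤ
        ≡⟨ cong (form S x y +_) (trans (sym (weight-mixed S P S-sym (back v) (back w)))
             (weight≡0 (back v) (back w) (v≢w ∘ Fin.↑ʳ-injective d v w))) ⟨
      form S x y + (eval (mixed S P (back v)) y + eval (P (back w)) x)
        ≡⟨ cong (λ z → form S x y + (z + eval (P (back w)) x)) (eval-zero (mixed≡0 v) y) ⟩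
      form S x y + (0ℤ + eval (P (back w)) x)
        ≡⟨ cong (form S x y +_) (ℤ.+-identityˡ _) ⟩
      form S x y + eval (P (back w)) x
        -- What is left is the mixed polynomial of `back w` at `x`, which vanishes as well.
        ≡⟨ eval-+ (λ k → eval (S k) y) (P (back w)) x ⟨
      eval (mixed S P (back w)) x
        ≡⟨ eval-zero (mixed≡0 w) x ⟩
      0ℤ ∎
      where
      x = pos (back v)
      y = pos (back w)
    -- The form is interpolated in its first argument over `middle`, then in its second over `last`,
    -- which reaches the single entries of `S`.
    S-row≡0 : ∀ i k → eval (S k) (pos (back (last i))) ≡ 0ℤ
    S-row≡0 i = vanishing-coefficients (pos ∘ back ∘ middle)
      (Fin.↑ˡ-injective (d ℕ.+ e) _ _ ∘ Fin.↑ʳ-injective d _ _ ∘ pos-injective) _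
      λ j → form≡0 (middle j) (last i) (↑ˡ≢↑ʳ j (i ↑ˡ e))
    S≡0 : ∀ k l → S k l ≡ 0ℤ
    S≡0 k = vanishing-coefficients (pos ∘ back ∘ last)
      (Fin.↑ˡ-injective e _ _ ∘ Fin.↑ʳ-injective d _ _ ∘ Fin.↑ʳ-injective d _ _ ∘ pos-injective) _
      λ i → S-row≡0 i k
    P≡0 : ∀ v k → P v k ≡ 0ℤ
    P≡0 v k with splitAt d v | Fin.join-splitAt d m v
    ... | inj₁ u | refl = P-head u k
    ... | inj₂ u | refl = begin
      P (back u) k                                     ≡⟨ ℤ.+-identityˡ _ ⟨
      0ℤ + P (back u) k                                ≡⟨ cong (_+ P (back u) k) (eval-zero (S≡0 k) (pos (back u))) ⟨
      mixed S P (back u) k                             ≡⟨ mixed≡0 u k ⟩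
      0ℤ                                               ∎

  -- Free parameters for the space of weights

  double-sum-+ : ∀ {r} {w : Fin r → ℕ} (f g : ∀ i → Fin (w i) → ℤ) →
    ∑[ i < r ] (∑[ j < w i ] (f i j + g i j)) ≡
    ∑[ i < r ] (∑[ j < w i ] f i j) + ∑[ i < r ] (∑[ j < w i ] g i j)
  double-sum-+ f g = trans (sum-cong-≗ λ i → ∑-distrib-+ (f i) (g i))
    (∑-distrib-+ (λ i → sum (f i)) (λ i → sum (g i)))

  triangular : ∀ {d} → (∀ (k : Fin d) → Fin (suc (toℕ k)) → ℤ) → Fin d → Fin d → ℤ
  triangular q k l = pad (q k) (toℕ l)

  -- A symmetric matrix is parametrised by a lower triangle `T` as `T` plus its transpose. The
  -- diagonal is doubled, which keeps the formula uniform and loses nothing over the integers.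
  symmetrised : ∀ {d} → (∀ (k : Fin d) → Fin (suc (toℕ k)) → ℤ) → Fin d → Fin d → ℤ
  symmetrised q k l = triangular q k l + triangular q l k

  -- This exhibits the form as linear in the unknowns `q k j`, with the coefficients that enter the
  -- linear system.
  form-symmetrised : ∀ {d} (q : ∀ (k : Fin d) → Fin (suc (toℕ k)) → ℤ) x y →
    form (symmetrised q) x y ≡
    ∑[ k < d ] (∑[ j < suc (toℕ k) ] (q k j * (x ^ toℕ k * y ^ toℕ j + y ^ toℕ k * x ^ toℕ j)))
  form-symmetrised {d} q x y = begin
    form (symmetrised q) x y
      ≡⟨ sum-cong-≗ (λ k → cong (_* x ^ toℕ k) (eval-+ (triangular q k) (flip (triangular q) k) y)) ⟩
    eval (λ k → eval (triangular q k) y + eval (flip (triangular q) k) y) x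
      ≡⟨ eval-+ (λ k → eval (triangular q k) y) (λ k → eval (flip (triangular q) k) y) x ⟩
    form (triangular q) x y + form (flip (triangular q)) x y
      ≡⟨ cong (form (triangular q) x y +_) (form-flip (flip (triangular q)) x y) ⟩
    form (triangular q) x y + form (triangular q) y x
      ≡⟨ cong₂ _+_ (ragged-form x y) (ragged-form y x) ⟩
    ∑[ k < d ] (∑[ j < suc (toℕ k) ] (q k j * (x ^ toℕ k * y ^ toℕ j))) +
    ∑[ k < d ] (∑[ j < suc (toℕ k) ] (q k j * (y ^ toℕ k * x ^ toℕ j)))
      ≡⟨ double-sum-+ {w = suc ∘ toℕ} (λ k j → q k j * (x ^ toℕ k * y ^ toℕ j))
                                       (λ k j → q k j * (y ^ toℕ k * x ^ toℕ j)) ⟨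
    ∑[ k < d ] (∑[ j < suc (toℕ k) ] (q k j * (x ^ toℕ k * y ^ toℕ j) + q k j * (y ^ toℕ k * x ^ toℕ j)))
      ≡⟨ sum-cong-≗ (λ k → sum-cong-≗ λ j → ℤ.*-distribˡ-+ (q k j) (x ^ toℕ k * y ^ toℕ j) (y ^ toℕ k * x ^ toℕ j)) ⟨
    ∑[ k < d ] (∑[ j < suc (toℕ k) ] (q k j * (x ^ toℕ k * y ^ toℕ j + y ^ toℕ k * x ^ toℕ j))) ∎
    where
    swap : ∀ a b c → a * b * c ≡ a * (c * b)
    swap = solve-∀
    ragged-form : ∀ x y → form (triangular q) x y ≡
      ∑[ k < d ] (∑[ j < suc (toℕ k) ] (q k j * (x ^ toℕ k * y ^ toℕ j)))
    ragged-form x y = sum-cong-≗ λ k → begin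
      eval (triangular q k) y * x ^ toℕ k
        ≡⟨ cong (_* x ^ toℕ k) (sum-pad (Fin.toℕ<n k) (q k) (y ^_)) ⟩
      (∑[ j < suc (toℕ k) ] (q k j * y ^ toℕ j)) * x ^ toℕ k
        ≡⟨ *-distribʳ-sum (x ^ toℕ k) (λ j → q k j * y ^ toℕ j) ⟩
      ∑[ j < suc (toℕ k) ] (q k j * y ^ toℕ j * x ^ toℕ k)
        ≡⟨ sum-cong-≗ (λ j → swap (q k j) (y ^ toℕ j) (x ^ toℕ k)) ⟩
      ∑[ j < suc (toℕ k) ] (q k j * (x ^ toℕ k * y ^ toℕ j)) ∎

  symmetrised-injective : ∀ {d} (q : ∀ (k : Fin d) → Fin (suc (toℕ k)) → ℤ) →
    (∀ k l → symmetrised q k l ≡ 0ℤ) → ∀ k j → q k j ≡ 0ℤ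
  symmetrised-injective {d} q S≡0 k j with ℕ.m≤n⇒m<n∨m≡n (ℕ.≤-pred (Fin.toℕ<n j))
  -- Below the diagonal the transposed entry lies beyond the end of row `l`, so it is padding.
  ... | inj₁ j<k = begin
    q k j                                              ≡⟨ pad-toℕ (q k) j ⟨
    pad (q k) (toℕ j)                                  ≡⟨ cong (pad (q k)) (Fin.toℕ-inject≤ j (Fin.toℕ<n k)) ⟨
    triangular q k l                                   ≡⟨ ℤ.+-identityʳ _ ⟨
    triangular q k l + 0ℤ                              ≡⟨ cong (triangular q k l +_) (pad-beyond (q l) l<k) ⟨
    symmetrised q k l                                  ≡⟨ S≡0 k l ⟩
    0ℤ                                                 ∎
    where
    l = inject≤ j (Fin.toℕ<n k)
    l<k : toℕ l ℕ.< toℕ k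
    l<k = subst (ℕ._< toℕ k) (sym (Fin.toℕ-inject≤ j (Fin.toℕ<n k))) j<k
  -- On the diagonal the entry is counted twice, so 2 has to be cancelled.
  ... | inj₂ j≡k = *-cancel-≢0 {ℤ.+ 2} (λ ()) (begin
    ℤ.+ 2 * q k j                                      ≡⟨ two (q k j) ⟩
    q k j + q k j                                      ≡⟨ cong (λ z → z + z) (pad-toℕ (q k) j) ⟨
    pad (q k) (toℕ j) + pad (q k) (toℕ j)              ≡⟨ cong (λ h → pad (q k) h + pad (q k) h) j≡k ⟩
    symmetrised q k k                                  ≡⟨ S≡0 k k ⟩
    0ℤ                                                 ∎)
    where
    two : ∀ z → ℤ.+ 2 * z ≡ z + z
    two = solve-∀

  extended : ∀ d {m r} → (Fin m → Fin r → ℤ) → Fin (d ℕ.+ m) → Fin d → ℤ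
  extended d p u k = [ const 0ℤ , (λ v → pad (p v) (toℕ k)) ]′ (splitAt d u)

  -- The row of `u` is a unit vector for a later vertex and zero for the first `d`. It turns the
  -- case distinction in `extended` into coefficients of a linear system.
  indicator : ∀ d {m} → Fin (d ℕ.+ m) → Fin m → ℤ
  indicator d u v = [ const 0ℤ , δ v ]′ (splitAt d u)

  eval-extended : ∀ d {m r} → r ℕ.≤ d → (p : Fin m → Fin r → ℤ) → ∀ u y →
    ∑[ v < m ] (∑[ j < r ] (p v j * (indicator d u v * y ^ toℕ j))) ≡ eval (extended d p u) y
  eval-extended d {m} {r} r≤d p u y = begin
    ∑[ v < m ] (∑[ j < r ] (p v j * (indicator d u v * y ^ toℕ j)))
      ≡⟨ sum-cong-≗ (λ v → sum-cong-≗ λ j → swap (p v j) (indicator d u v) (y ^ toℕ j)) ⟩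
    ∑[ v < m ] (∑[ j < r ] (p v j * y ^ toℕ j * indicator d u v))
      ≡⟨ sum-cong-≗ (λ v → *-distribʳ-sum (indicator d u v) (λ j → p v j * y ^ toℕ j)) ⟨
    ∑[ v < m ] (eval (p v) y * indicator d u v)
      ≡⟨ select (splitAt d u) ⟩
    eval (extended d p u) y ∎
    where
    swap : ∀ a b c → a * (b * c) ≡ a * c * b
    swap = solve-∀
    select : ∀ (s : Fin d ⊎ Fin m) →
      ∑[ v < m ] (eval (p v) y * [ const 0ℤ , δ v ]′ s) ≡
      eval (λ (k : Fin d) → [ const 0ℤ , (λ v → pad (p v) (toℕ k)) ]′ s) y
    select (inj₁ _) = trans (sum-zero λ v → ℤ.*-zeroʳ (eval (p v) y)) (sym (sum-zero {d} λ k → ℤ.*-zeroˡ (y ^ toℕ k)))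
    select (inj₂ w) = trans (sum-δ (λ v → eval (p v) y) w) (sym (sum-pad r≤d (p w) (y ^_)))

  -- Each listed edge imposes one linear equation on the parameters, and there are more parameters
  -- than equations. A nonzero parameter vector gives a nonzero pair because both parametrisations
  -- are injective.
  nontrivial-weight : ∀ d m r {M} → r ℕ.≤ d → (es : Fin M → Fin (d ℕ.+ m) × Fin (d ℕ.+ m)) →
    M ℕ.< ℕΣ.sum {d} (suc ∘ toℕ) ℕ.+ ℕΣ.sum {m} (const r) →
    ∃ λ (S : Fin d → Fin d → ℤ) → ∃ λ (P : Fin (d ℕ.+ m) → Fin d → ℤ) →
      (∀ k l → S k l ≡ S l k) ×
      (∀ u k → P (u ↑ˡ m) k ≡ 0ℤ) ×
      (∀ v k → r ℕ.≤ toℕ k → P v k ≡ 0ℤ) ×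
      ¬ ((∀ k l → S k l ≡ 0ℤ) × (∀ v k → P v k ≡ 0ℤ)) ×
      (∀ e → weight S P (proj₁ (es e)) (proj₂ (es e)) ≡ 0ℤ)
  nontrivial-weight d m r {M} r≤d es M<N =
    S , P , (λ k l → ℤ.+-comm (triangular q k l) (triangular q l k)) , P-head , P-low , nonzero , on-edges
    where
    fst snd : Fin M → Fin (d ℕ.+ m)
    fst = proj₁ ∘ es
    snd = proj₂ ∘ es
    x y : Fin M → ℤ
    x = pos ∘ fst
    y = pos ∘ snd
    solution = underdetermined-ragged {M} {d} {m} (suc ∘ toℕ) (const r) M<N
      (λ e k j → x e ^ toℕ k * y e ^ toℕ j + y e ^ toℕ k * x e ^ toℕ j)
      (λ e v j → indicator d (fst e) v * y e ^ toℕ j + indicator d (snd e) v * x e ^ toℕ j)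
    q = proj₁ solution
    p = proj₁ (proj₂ solution)
    S = symmetrised q
    P = extended d p
    P-head : ∀ u k → P (u ↑ˡ m) k ≡ 0ℤ
    P-head u k = cong [ const 0ℤ , (λ v → pad (p v) (toℕ k)) ]′ (Fin.splitAt-↑ˡ d u m)
    P-low : ∀ v k → r ℕ.≤ toℕ k → P v k ≡ 0ℤ
    P-low v k r≤k with splitAt d v
    ... | inj₁ _ = refl
    ... | inj₂ w = pad-beyond (p w) r≤k
    nonzero : ¬ ((∀ k l → S k l ≡ 0ℤ) × (∀ v k → P v k ≡ 0ℤ))
    nonzero (S≡0 , P≡0) = proj₁ (proj₂ (proj₂ solution)) (symmetrised-injective q S≡0 , λ w j → begin
      p w j                              ≡⟨ pad-toℕ (p w) j ⟨
      pad (p w) (toℕ j)                  ≡⟨ cong (pad (p w)) (Fin.toℕ-inject≤ j r≤d) ⟨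
      pad (p w) (toℕ (inject≤ j r≤d))    ≡⟨ cong [ const 0ℤ , (λ v → pad (p v) _) ]′ (Fin.splitAt-↑ʳ d m w) ⟨
      P (d ↑ʳ w) (inject≤ j r≤d)         ≡⟨ P≡0 (d ↑ʳ w) (inject≤ j r≤d) ⟩
      0ℤ                                 ∎)
    on-edges : ∀ e → weight S P (fst e) (snd e) ≡ 0ℤ
    on-edges e = trans
      (cong₂ _+_ (form-symmetrised q (x e) (y e)) (begin
        eval (P (fst e)) (y e) + eval (P (snd e)) (x e)
          ≡⟨ cong₂ _+_ (eval-extended d r≤d p (fst e) (y e)) (eval-extended d r≤d p (snd e) (x e)) ⟨
        ∑[ v < m ] (∑[ j < r ] f v j) + ∑[ v < m ] (∑[ j < r ] g v j)
          ≡⟨ double-sum-+ f g ⟨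
        ∑[ v < m ] (∑[ j < r ] (f v j + g v j))
          ≡⟨ sum-cong-≗ (λ v → sum-cong-≗ λ j → ℤ.*-distribˡ-+ (p v j)
               (indicator d (fst e) v * y e ^ toℕ j) (indicator d (snd e) v * x e ^ toℕ j)) ⟨
        ∑[ v < m ] (∑[ j < r ] (p v j * (indicator d (fst e) v * y e ^ toℕ j + indicator d (snd e) v * x e ^ toℕ j))) ∎))
      (proj₂ (proj₂ (proj₂ solution)) e)
      where
      f g : Fin m → Fin r → ℤ
      f v j = p v j * (indicator d (fst e) v * y e ^ toℕ j)
      g v j = p v j * (indicator d (snd e) v * x e ^ toℕ j)

open LinearAlgebra

open import Data.Nat.Base using (ℕ; _+_; _*_; _∸_; _≤_; _<_; _≥_)
open import Data.Nat.Combinatorics using (_C_)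
import Data.Nat.Tactic.RingSolver as ℕ-RingSolver

-- Spreading zeros along the saturation process

∈-edges : ∀ {n} (G : Graph n) {u v} → toℕ u < toℕ v → Adj G u v → (u , v) ∈ edges G
∈-edges G {u} {v} u<v uv = ∈-filter⁺ (λ (u , v) → (u Fin.<? v) ×-dec adj? G u v)
  (∈-cartesianProduct⁺ (∈-allFin u) (∈-allFin v)) (u<v , uv)

module _ {n} (g : Fin n → Fin n → ℤ) (g-comm : ∀ u v → g u v ≡ g v u) where

  -- This is the interface between algebra and graphs: the saturation argument learns about the
  -- weight only this and its symmetry.
  CopyRigid : ℕ → ℕ → Set
  CopyRigid s t = (α : Fin s → Fin n) (β : Fin t → Fin n) → Injective _≡_ _≡_ α → Injective _≡_ _≡_ β →
    ∀ i j → (∀ i′ j′ → ¬ (i′ ≡ i × j′ ≡ j) → g (α i′) (β j′) ≡ 0ℤ) → g (α i) (β j) ≡ 0ℤ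

  vanishes-on-Adj : ∀ {G : Graph n} → (∀ {u v} → (u , v) ∈ edges G → g u v ≡ 0ℤ) →
    ∀ {u v} → Adj G u v → g u v ≡ 0ℤ
  vanishes-on-Adj {G} on-edges {u} {v} uv with Fin.<-cmp u v
  ... | tri< u<v _ _ = on-edges (∈-edges G u<v uv)
  ... | tri≈ _ u≡v _ = contradiction uv (adj-irrefl G u≡v)
  ... | tri> _ _ v<u = trans (g-comm u v) (on-edges (∈-edges G v<u (adj-sym G uv)))

  -- Both orientations of the distinguished edge are excluded from `others`, since an unordered edge
  -- appears there as either ordered pair.
  copy-forces : ∀ {s t} → CopyRigid s t → ∀ {G : Graph n} (c : Copy (Kbip s t) G) {u v} → (u , v) ∈E c →
    (∀ {u′ v′} → Adj G u′ v′ → (u′ , v′) ≢ (u , v) → (v′ , u′) ≢ (u , v) → g u′ v′ ≡ 0ℤ) →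
    g u v ≡ 0ℤ
  copy-forces {s} {t} rigid {G} c {u} {v} (x , y , xy , refl , refl) others =
    cases (splitAt s x) (splitAt s y) xy (Fin.join-splitAt s t x) (Fin.join-splitAt s t y)
    where
    φ = embed c
    α : Fin s → Fin n
    α i = φ (i ↑ˡ t)
    β : Fin t → Fin n
    β j = φ (s ↑ʳ j)
    α-inj : Injective _≡_ _≡_ α
    α-inj = Fin.↑ˡ-injective t _ _ ∘ injective c
    β-inj : Injective _≡_ _≡_ β
    β-inj = Fin.↑ʳ-injective s _ _ ∘ injective c
    α≢β : ∀ i j → α i ≢ β j
    α≢β i j eq = ↑ˡ≢↑ʳ i j (injective c eq)
    adjacent : ∀ i j → Adj G (α i) (β j)
    adjacent i j = preserves c
      (subst₂ OppositeParts (sym (Fin.splitAt-↑ˡ s i t)) (sym (Fin.splitAt-↑ʳ s t j)) tt)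
    cases : (p q : Fin s ⊎ Fin t) → OppositeParts p q → join s t p ≡ x → join s t q ≡ y → g (φ x) (φ y) ≡ 0ℤ
    cases (inj₁ i) (inj₂ j) _ refl refl = rigid α β α-inj β-inj i j λ i′ j′ ≢ij → others (adjacent i′ j′)
      (λ eq → ≢ij (α-inj (cong proj₁ eq) , β-inj (cong proj₂ eq)))
      -- A reversed pair could agree with the distinguished one only if a vertex lay on both sides
      -- of the copy.
      (λ eq → α≢β i j′ (sym (cong proj₁ eq)))
    cases (inj₂ j) (inj₁ i) _ refl refl = trans (g-comm _ _) (rigid α β α-inj β-inj i j λ i′ j′ ≢ij →
      others (adjacent i′ j′)
      (λ eq → α≢β i′ j (cong proj₁ eq))
      (λ eq → ≢ij (α-inj (cong proj₂ eq) , β-inj (cong proj₁ eq))))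

  -- By induction along the ordering: when an edge is added, the other edges of the copy it creates
  -- lie in `G` or were added earlier, so their values are already zero and rigidity gives the new
  -- one.
  vanishes-everywhere : ∀ {s t} → CopyRigid s t → ∀ {G : Graph n} → WeaklySaturated (K n) (Kbip s t) G →
    (∀ {u v} → (u , v) ∈ edges G → g u v ≡ 0ℤ) → ∀ u v → u ≢ v → g u v ≡ 0ℤ
  vanishes-everywhere {s} {t} rigid {G} ws on-edges u v u≢v = vanishes-on-Adj {K n} on-pairs u≢v
    where
    open WeaklySaturated ws
    on-prefix : ∀ k → k ≤ length order → ∀ {u v} → (u , v) ∈ take k order → g u v ≡ 0ℤ
    on-prefix zero    _     ()
    on-prefix (suc k) k<len {u} {v} uv∈ =
      [ on-prefix k (ℕ.<⇒≤ k<len) , (λ { (here refl) → on-last }) ]′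
        (∈-++⁻ (take k order) (subst ((u , v) ∈_) prefix uv∈))
      where
      i = fromℕ< k<len
      e = lookup order i
      -- Stage `i` counts from 0, so its prefix of length `suc k` ends in exactly the new edge `e`.
      prefix : take (suc k) order ≡ take k order ∷ʳ e
      prefix = subst (λ h → take (suc h) order ≡ take h order ∷ʳ e) (Fin.toℕ-fromℕ< k<len) (take-suc order i)
      on-last : g (proj₁ e) (proj₂ e) ≡ 0ℤ
      on-last = copy-forces rigid (proj₁ (creates i)) (proj₂ (creates i)) λ
        { (inj₁ adj) _ _ → vanishes-on-Adj {G} on-edges adj
        ; (inj₂ (_ , inj₁ m)) ≢e _ → earlier m ≢e
        ; (inj₂ (_ , inj₂ m)) _ ≢e → trans (g-comm _ _) (earlier m ≢e) }
        where
        earlier : ∀ {u v} → (u , v) ∈ take (suc (toℕ i)) order → (u , v) ≢ e → g u v ≡ 0ℤ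
        earlier {u} {v} m ≢e =
          [ on-prefix k (ℕ.<⇒≤ k<len) , (λ { (here eq) → contradiction eq ≢e }) ]′
            (∈-++⁻ (take k order)
              (subst ((u , v) ∈_) (trans (cong (λ h → take (suc h) order) (Fin.toℕ-fromℕ< k<len)) prefix) m))
    on-pairs : ∀ {u v} → (u , v) ∈ edges (K n) → g u v ≡ 0ℤ
    on-pairs {u} {v} uv∈ with (u , v) ∈? edges G
    ... | yes uv∈G = on-edges uv∈G
    ... | no  uv∉G = on-prefix (length order) ℕ.≤-refl
      (subst ((u , v) ∈_) (sym (take-all (length order) order ℕ.≤-refl))
        (Equivalence.from (proj₂ ordering (u , v)) (uv∈ , uv∉G)))

-- The lower bound and its arithmetic

dimension-bound : ∀ r d e → r ≤ d → let n = d + (d + (d + e)) in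
  ∀ (G : Graph n) → WeaklySaturated (K n) (Kbip (suc r) (suc d)) G →
  ℕΣ.sum {d} (suc ∘ toℕ) + ℕΣ.sum {d + (d + e)} (const r) ≤ edgeCount G
dimension-bound r d e r≤d G ws = ℕ.≮⇒≥ λ few →
  let S , P , S-sym , P-head , P-low , nonzero , on-edges =
        nontrivial-weight d (d + (d + e)) r r≤d (lookup (edges G)) few
      vanish : ∀ {u v} → (u , v) ∈ edges G → weight S P u v ≡ 0ℤ
      vanish uv∈ = subst (λ (u , v) → weight S P u v ≡ 0ℤ) (sym (lookup-index uv∈)) (on-edges (index uv∈))
  in nonzero (weight-faithful d e S P S-sym P-head
       (vanishes-everywhere (weight S P) (weight-comm S P S-sym) (weight-forced S P S-sym P-low) ws vanish))

-- Since `3 * suc d ∸ 3` is `3 * d`, the hypothesis provides the three blocks, and `e` counts the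
-- surplus vertices.
vertex-count : ∀ d {n} → n ≥ 3 * suc d ∸ 3 → ∃ λ e → d + (d + (d + e)) ≡ n
vertex-count d {n} n≥ =
  let e , 3d+e≡n = ℕ.m≤n⇒∃[o]m+o≡n
        (subst (_≤ n) (trans (cong (_∸ 3) (ℕ.*-suc 3 d)) (ℕ.m+n∸m≡n 3 (3 * d))) n≥)
  in e , trans (regroup d e) 3d+e≡n
  where
  regroup : ∀ d e → d + (d + (d + e)) ≡ 3 * d + e
  regroup = ℕ-RingSolver.solve-∀

-- For `t = suc d`, the factor `n ∸ t + 1` is the number of vertices after the first `d`. Having
-- `suc m` of them keeps the truncated subtraction exact.
d+m∸[1+d]+1≡m : ∀ d m → d + suc m ∸ suc d + 1 ≡ suc m
d+m∸[1+d]+1≡m d m = begin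
  d + suc m ∸ suc d + 1     ≡⟨ cong (λ k → k ∸ suc d + 1) (ℕ.+-suc d m) ⟩
  d + m ∸ d + 1             ≡⟨ cong (_+ 1) (ℕ.m+n∸m≡n d m) ⟩
  m + 1                     ≡⟨ ℕ.+-comm m 1 ⟩
  suc m                     ∎
  where open ≡-Reasoning

proposition15 : ∀ (s t n : ℕ) → 2 ≤ s → s < t → n ≥ 3 * t ∸ 3 →
    ∀ (wsat : ℕ) → IsWsat (K n) (Kbip s t) wsat →
    wsat ≥ (s ∸ 1) * (n ∸ t + 1) + (t C 2)
proposition15 (suc r) (suc d@(suc d′)) n 2≤s (s<s r<d) n≥ wsat isWsat
  -- The minimum is attained, so it suffices to bound the edges of one weakly saturated graph.
  with G , ws , refl ← IsWsat.attained isWsat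
  with e , refl ← vertex-count d n≥
  = subst (_≤ edgeCount G) count (dimension-bound r d e (ℕ.<⇒≤ r<d) G ws)
  where
  open ≡-Reasoning
  count : ∀ {e} → ℕΣ.sum {d} (suc ∘ toℕ) + ℕΣ.sum {d + (d + e)} (const r) ≡
                  r * (d + (d + (d + e)) ∸ suc d + 1) + (suc d C 2)
  count {e} = begin
    ℕΣ.sum {d} (suc ∘ toℕ) + ℕΣ.sum {d + (d + e)} (const r)
      ≡⟨ cong₂ _+_ (sum-triangle d) (sum-const (d + (d + e)) r) ⟩
    suc d C 2 + (d + (d + e)) * r
      ≡⟨ ℕ.+-comm (suc d C 2) _ ⟩
    (d + (d + e)) * r + suc d C 2
      ≡⟨ cong (_+ suc d C 2) (ℕ.*-comm (d + (d + e)) r) ⟩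
    r * (d + (d + e)) + suc d C 2
      -- Here `d = suc d′` shows that the number of later vertices is positive.
      ≡⟨ cong (λ m → r * m + suc d C 2) (d+m∸[1+d]+1≡m d (d′ + (d + e))) ⟨
    r * (d + (d + (d + e)) ∸ suc d + 1) + suc d C 2 ∎
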